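{- If $G$ and $G'$ are non-isomorphic graphs that have the same order $n$, then $\mathrm{D}_1(G,G')\le (n+3)/2$.
   Context: Graphs are finite, undirected and loopless; the order is the number of vertices. A graph is regarded as a structure with a single irreflexive symmetric binary predicate $E$ (adjacency). First order formulas use $E$, $=$ and the connectives $\neg,\wedge,\vee$. A closed formula $\Phi$ distinguishes $G$ from $G'$ if it is true on $G$ and false on $G'$. The set $\mathrm{Nest}(\Phi)$ of sequences of nested quantifiers is defined inductively: $\mathrm{Nest}(\Phi)=\{\epsilon\}$ (the empty word) for atomic $\Phi$; $\mathrm{Nest}(\neg\Phi)$ is obtained from $\mathrm{Nest}(\Phi)$ by exchanging $\exists$ and $\forall$ in all words; $\mathrm{Nest}(\Phi\wedge\Psi)=\mathrm{Nest}(\Phi\vee\Psi)=\mathrm{Nest}(\Phi)\cup\mathrm{Nest}(\Psi)$; $\mathrm{Nest}(\exists x\Phi)$ and $\mathrm{Nest}(\forall x\Phi)$ are obtained by prepending $\exists$, respectively $\forall$, to every word of $\mathrm{Nest}(\Phi)$. The quantifier rank of $\Phi$ is the maximum length of a word in $\mathrm{Nest}(\Phi)$; the alternation number of $\Phi$ is the maximum, over words in $\mathrm{Nest}(\Phi)$, of the number of occurrences of $\exists\forall$ and $\forall\exists$ as consecutive letters. $\mathrm{D}_k(G,G')$ is the minimum quantifier rank of a formula with alternation number at most $k$ distinguishing $G$ from $G'$. -}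

module Defs where

open import Data.Fin.Base using (Fin)
open import Data.List.Base using (List; []; _∷_; _++_; map; length)
open import Data.List.Extrema.Nat using (max)
open import Data.Nat.Base using (ℕ; suc; _≤_)
open import Data.Product.Base using (Σ; ∃-syntax; _×_)
open import Data.Sum.Base using (_⊎_)
open import Data.Vec.Base using (Vec; []; _∷_; lookup)
open import Function.Bundles using (_↔_; _⇔_; Inverse)
open import Level using (0ℓ)
open import Relation.Binary.Core using (Rel)
open import Relation.Binary.Definitions using (Decidable; Irreflexive; Symmetric)
open import Relation.Binary.PropositionalEquality.Core using (_≡_)
open import Relation.Nullary.Negation.Core using (¬_)

-- Graphs of order n, with vertex set Fin n.  Decidability of adjacency is
-- automatic classically; it makes the graph finite data constructively.
record Graph (n : ℕ) : Set₁ where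
  field
    Adj   : Rel (Fin n) 0ℓ
    adj?  : Decidable Adj
    sym   : Symmetric Adj
    irref : Irreflexive _≡_ Adj

open Graph public using (Adj)

infix 4 _≅_

_≅_ : ∀ {m n} → Graph m → Graph n → Set
_≅_ {m} {n} G G′ =
  Σ (Fin m ↔ Fin n) λ f →
    ∀ x y → Adj G x y ⇔ Adj G′ (Inverse.to f x) (Inverse.to f y)

-- Formula k: formulas with free variables among k de Bruijn indices; a
-- quantifier binds index zero of its body.
data Formula (k : ℕ) : Set where
  E′ _=′_   : Fin k → Fin k → Formula k
  ¬′_       : Formula k → Formula k
  _∧′_ _∨′_ : Formula k → Formula k → Formula k
  ∃′_ ∀′_   : Formula (suc k) → Formula k

infix 4 _,_⊨_

_,_⊨_ : ∀ {n k} → Graph n → Vec (Fin n) k → Formula k → Set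
G , ρ ⊨ E′ i j   = Adj G (lookup ρ i) (lookup ρ j)
G , ρ ⊨ (i =′ j) = lookup ρ i ≡ lookup ρ j
G , ρ ⊨ (¬′ Φ)   = ¬ (G , ρ ⊨ Φ)
G , ρ ⊨ (Φ ∧′ Ψ) = (G , ρ ⊨ Φ) × (G , ρ ⊨ Ψ)
G , ρ ⊨ (Φ ∨′ Ψ) = (G , ρ ⊨ Φ) ⊎ (G , ρ ⊨ Ψ)
G , ρ ⊨ (∃′ Φ)   = ∃[ x ] (G , x ∷ ρ ⊨ Φ)
G , ρ ⊨ (∀′ Φ)   = ∀ x → G , x ∷ ρ ⊨ Φ

Distinguishes : ∀ {m n} → Formula 0 → Graph m → Graph n → Set
Distinguishes Φ G G′ = (G , [] ⊨ Φ) × ¬ (G′ , [] ⊨ Φ)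

data Quantifier : Set where
  ex all : Quantifier

dual : Quantifier → Quantifier
dual ex  = all
dual all = ex

Nest : ∀ {k} → Formula k → List (List Quantifier)
Nest (E′ i j)  = [] ∷ []
Nest (i =′ j)  = [] ∷ []
Nest (¬′ Φ)    = map (map dual) (Nest Φ)
Nest (Φ ∧′ Ψ)  = Nest Φ ++ Nest Ψ
Nest (Φ ∨′ Ψ)  = Nest Φ ++ Nest Ψ
Nest (∃′ Φ)    = map (ex ∷_) (Nest Φ)
Nest (∀′ Φ)    = map (all ∷_) (Nest Φ)

alternations : List Quantifier → ℕ
alternations []                = 0
alternations (q ∷ [])          = 0
alternations (ex  ∷ ex  ∷ w)   = alternations (ex ∷ w)
alternations (ex  ∷ all ∷ w)   = suc (alternations (all ∷ w))
alternations (all ∷ ex  ∷ w)   = suc (alternations (ex ∷ w))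
alternations (all ∷ all ∷ w)   = alternations (all ∷ w)

-- Nest Φ is never empty, so the default 0 does not affect these maxima.
quantifierRank : ∀ {k} → Formula k → ℕ
quantifierRank Φ = max 0 (map length (Nest Φ))

alternationNumber : ∀ {k} → Formula k → ℕ
alternationNumber Φ = max 0 (map alternations (Nest Φ))

-- D k G G′ d says that d is the value of D_k(G, G′).  It is a relation because
-- the minimum is undefined when no formula with alternation number at most k
-- distinguishes the graphs.
record D {m n : ℕ} (k : ℕ) (G : Graph m) (G′ : Graph n) (d : ℕ) : Set where
  field
    attained : ∃[ Φ ] (alternationNumber Φ ≤ k × Distinguishes Φ G G′
                       × quantifierRank Φ ≡ d)
    minimal  : ∀ Φ → alternationNumber Φ ≤ k → Distinguishes Φ G G′ →
               d ≤ quantifierRank Φ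

{-# OPTIONS --safe #-}

-- Distinguishability is decided by the Ehrenfeucht–Fraïssé game, so it suffices
-- that Spoiler wins with at most one alternation.  The type of a vertex over a
-- set X records equality and adjacency with the members of X.  Grow X as long as
-- one more vertex raises the number of types by two; it ends with at least
-- 2|X| + 1 types and with every class of two or more vertices homogeneous
-- towards every class.  Spoiler plays X in G.  If the classes over X have
-- different sizes in G and G′, he exhausts a class inside one graph, choosing the
-- graph where this is cheaper.  If the sizes agree, refine the types by adjacency
-- to the vertices with a class of their own: either the refined classes match and
-- yield an isomorphism, or Spoiler exhausts a refined class and exposes the
-- difference with one further move, still inside one graph.  Large classes leave
-- few vertices for the 2|X| + 1 types, which pays for exhausting them.
module Submission where

open import Defs
open import Data.Bool.Base using (Bool; true; _∧_)
import Data.Bool.Properties as Bool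
open import Data.Empty using (⊥)
open import Data.Fin.Base using (Fin; zero; suc; inject≤; punchOut; _↑ˡ_; _↑ʳ_)
import Data.Fin.Properties as Fin
open import Data.List.Base
  using (List; []; _∷_; length; filter; allFin) renaming (map to mapₗ; _++_ to _++ₗ_)
import Data.List.Base as List
open import Data.List.Extrema.Nat using (xs≤max; max≤v⁺)
open import Data.List.Membership.Propositional using (_∈_)
open import Data.List.Membership.Propositional.Properties
  using (∈-lookup; ∈-allFin; ∈-filter⁺; ∈-filter⁻; ∈-map⁺; ∈-map⁻; ∈-++⁺ˡ)
open import Data.List.Membership.Setoid.Properties using (index-injective)
open import Data.List.Properties using (length-map; length-++; length-tabulate; length-filter)
open import Data.List.Relation.Binary.Subset.Propositional using (_⊆_)
open import Data.List.Relation.Unary.All as All using (All; []; _∷_)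
import Data.List.Relation.Unary.All.Properties as All
open import Data.List.Relation.Unary.AllPairs as AllPairs using (AllPairs; []; _∷_)
import Data.List.Relation.Unary.AllPairs.Properties as AllPairs
open import Data.List.Relation.Unary.Any using (index; here; there)
open import Data.List.Relation.Unary.Unique.Propositional using (Unique)
import Data.List.Relation.Unary.Unique.Propositional.Properties as Unique
open import Data.Nat.Base
  using (ℕ; zero; suc; pred; _+_; _*_; _∸_; _≤_; _<_; z≤n; s≤s; s≤s⁻¹; ⌊_/2⌋)
import Data.Nat.Properties as ℕ
open import Data.Nat.Tactic.RingSolver using (solve-∀)
open import Data.Product.Base using (∃-syntax; ∃₂; _×_; _,_; proj₁; proj₂)
import Data.Product.Properties as Product
open import Data.Sum.Base as Sum using (inj₁; inj₂)
open import Data.Unit.Base using (⊤; tt)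
open import Data.Vec.Base as Vec using (Vec; []; _∷_; lookup; tabulate; _++_)
open import Data.Vec.Properties
  using (≡-dec; ∷-injective; lookup∘tabulate; tabulate-cong; lookup-++ˡ; lookup-++ʳ)
open import Function.Base using (_∘_)
open import Function.Bundles using (_↔_; mk⇔; mk↔ₛ′)
open import Function.Definitions using (Injective)
open import Relation.Binary.Definitions using (DecidableEquality)
open import Relation.Binary.PropositionalEquality
open import Relation.Nullary using (¬_; Dec; yes; no; does; contradiction)
open import Relation.Nullary.Decidable
  using (¬?; map′; _×-dec_; _→-dec_; dec-true; dec-false; does-⇔; decidable-stable)
open import Relation.Unary using (Decidable)

private
  variable
    k m n r e a : ℕ
    A U W : Set

-- The game with bounded alternation

Link : Set
Link = Bool × Bool

infix 4 _≟ₗ_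

_≟ₗ_ : DecidableEquality Link
_≟ₗ_ = Product.≡-dec Bool._≟_ Bool._≟_

link : Graph n → Fin n → Fin n → Link
link G x y = does (x Fin.≟ y) , does (Graph.adj? G x y)

does-true : {P : Set} (P? : Dec P) → does P? ≡ true → P
does-true (yes p) _ = p

does-transport : {P Q : Set} (P? : Dec P) (Q? : Dec Q) → does P? ≡ does Q? → P → Q
does-transport P? Q? eq p = does-true Q? (trans (sym eq) (dec-true P? p))

module _ {G : Graph m} {G′ : Graph n} {x y : Fin m} {x′ y′ : Fin n}
         (eq : link G x y ≡ link G′ x′ y′) where

  link-≡ : x ≡ y → x′ ≡ y′
  link-≡ = does-transport (x Fin.≟ y) (x′ Fin.≟ y′) (cong proj₁ eq)

  link-Adj : Adj G x y → Adj G′ x′ y′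
  link-Adj = does-transport (Graph.adj? G x y) (Graph.adj? G′ x′ y′) (cong proj₂ eq)

record Same (G : Graph m) (G′ : Graph n) (ρ : Vec (Fin m) k) (ρ′ : Vec (Fin n) k) : Set where
  constructor same-links
  field
    link≡ : ∀ i j → link G (lookup ρ i) (lookup ρ j) ≡ link G′ (lookup ρ′ i) (lookup ρ′ j)

open Same

-- Duplicator wins the r-round Ehrenfeucht–Fraïssé game from (ρ , ρ′) when
-- Spoiler may make at most e − 1 alternations if the next move is in G, and at
-- most a − 1 if it is in G′ (budget 0 forbids the move).
Dup : (r e a : ℕ) (G : Graph m) (G′ : Graph n) → Vec (Fin m) k → Vec (Fin n) k → Set
Dup zero    e a G G′ ρ ρ′ = Same G G′ ρ ρ′
Dup (suc r) e a G G′ ρ ρ′ =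
  Same G G′ ρ ρ′
  × (0 < e → ∀ x → ∃[ x′ ] Dup r e (pred e) G G′ (x ∷ ρ) (x′ ∷ ρ′))
  × (0 < a → ∀ x′ → ∃[ x ] Dup r (pred a) a G G′ (x ∷ ρ) (x′ ∷ ρ′))

-- A quantifier word read as a sequence of Spoiler's moves, `ex` in the first graph and `all` in the
-- second, with the budgets of `Dup`.
Fits : (r e a : ℕ) → List Quantifier → Set
Fits r       e a []        = ⊤
Fits zero    e a (q ∷ w)   = ⊥
Fits (suc r) e a (ex ∷ w)  = 0 < e × Fits r e (pred e) w
Fits (suc r) e a (all ∷ w) = 0 < a × Fits r (pred a) a w

same : ∀ {G : Graph m} {G′ : Graph n} {ρ : Vec _ k} {ρ′} → Dup r e a G G′ ρ ρ′ → Same G G′ ρ ρ′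
same {r = zero}  s       = s
same {r = suc r} (s , _) = s

-- Needed for negation, which exchanges the graphs and dualises every word.
dup-swap : ∀ {G : Graph m} {G′ : Graph n} {ρ : Vec _ k} {ρ′} →
           Dup r e a G G′ ρ ρ′ → Dup r a e G′ G ρ′ ρ
dup-swap {r = zero}  s           = same-links λ i j → sym (link≡ s i j)
dup-swap {r = suc r} (s , f , g) =
  same-links (λ i j → sym (link≡ s i j)) ,
  (λ p x → let y , d = g p x in y , dup-swap {r = r} d) ,
  (λ p x → let y , d = f p x in y , dup-swap {r = r} d)

fits-dual : ∀ r {e a} w → Fits r e a (mapₗ dual w) → Fits r a e w
fits-dual r       []        _       = tt
fits-dual (suc r) (ex ∷ w)  (p , f) = p , fits-dual r w f
fits-dual (suc r) (all ∷ w) (p , f) = p , fits-dual r w f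

-- For the quantifier cases of `dup-sound`: from some word one reads off that a round remains and
-- that the move is within budget.
nest-nonempty : (Φ : Formula k) → ∃[ w ] w ∈ Nest Φ
nest-nonempty (E′ i j)  = [] , here refl
nest-nonempty (i =′ j)  = [] , here refl
nest-nonempty (¬′ Φ)    = let w , p = nest-nonempty Φ in _ , ∈-map⁺ _ p
nest-nonempty (Φ ∧′ Ψ)  = let w , p = nest-nonempty Φ in w , ∈-++⁺ˡ p
nest-nonempty (Φ ∨′ Ψ)  = let w , p = nest-nonempty Φ in w , ∈-++⁺ˡ p
nest-nonempty (∃′ Φ)    = let w , p = nest-nonempty Φ in _ , ∈-map⁺ _ p
nest-nonempty (∀′ Φ)    = let w , p = nest-nonempty Φ in _ , ∈-map⁺ _ p

-- Induction on the formula. Duplicator's reply to a witness of `∃′` is a witness in `G′`; under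
-- `∀′`, each vertex of `G′` is a move of Spoiler, and the formula is known at the reply in `G`.
dup-sound : ∀ {G : Graph m} {G′ : Graph n} {ρ : Vec _ k} {ρ′} (Φ : Formula k) →
            All (Fits r e a) (Nest Φ) → Dup r e a G G′ ρ ρ′ → G , ρ ⊨ Φ → G′ , ρ′ ⊨ Φ
dup-sound {r = r} {G = G} {G′} (E′ i j) _ d = link-Adj {G = G} {G′} (link≡ (same {r = r} d) i j)
dup-sound {r = r} {G = G} {G′} (i =′ j) _ d = link-≡ {G = G} {G′} (link≡ (same {r = r} d) i j)
dup-sound {r = r} (¬′ Φ) fs d ¬Φ Φ′ =
  ¬Φ (dup-sound Φ (All.map (λ {w} → fits-dual r w) (All.map⁻ fs)) (dup-swap {r = r} d) Φ′)
dup-sound (Φ ∧′ Ψ) fs d (p , q) =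
  dup-sound Φ (All.++⁻ˡ (Nest Φ) fs) d p , dup-sound Ψ (All.++⁻ʳ (Nest Φ) fs) d q
dup-sound (Φ ∨′ Ψ) fs d =
  Sum.map (dup-sound Φ (All.++⁻ˡ (Nest Φ) fs) d) (dup-sound Ψ (All.++⁻ʳ (Nest Φ) fs) d)
dup-sound {r = r} (∃′ Φ) fs d (x , p) with All.map⁻ fs
... | fs′ with All.lookup fs′ (proj₂ (nest-nonempty Φ))
dup-sound {r = suc r} (∃′ Φ) fs (_ , f , _) (x , p) | fs′ | 0<e , _ =
  let x′ , d = f 0<e x in x′ , dup-sound Φ (All.map proj₂ fs′) d p
dup-sound {r = r} (∀′ Φ) fs d p with All.map⁻ fs
... | fs′ with All.lookup fs′ (proj₂ (nest-nonempty Φ))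
dup-sound {r = suc r} (∀′ Φ) fs (_ , _ , g) p | fs′ | 0<a , _ = λ x′ →
  let x , d = g 0<a x′ in dup-sound Φ (All.map proj₂ fs′) d (p x)

-- Deciding the game and building separating formulas

same? : (G : Graph m) (G′ : Graph n) (ρ : Vec _ k) (ρ′ : Vec _ k) → Dec (Same G G′ ρ ρ′)
same? G G′ ρ ρ′ = map′ same-links link≡
  (Fin.all? λ i → Fin.all? λ j → link G _ _ ≟ₗ link G′ _ _)

dup? : ∀ r e a (G : Graph m) (G′ : Graph n) (ρ : Vec _ k) ρ′ → Dec (Dup r e a G G′ ρ ρ′)
dup? zero    e a G G′ ρ ρ′ = same? G G′ ρ ρ′
dup? (suc r) e a G G′ ρ ρ′ =
  same? G G′ ρ ρ′
  ×-dec (0 ℕ.<? e →-dec Fin.all? λ x → Fin.any? λ x′ → dup? r e (pred e) G G′ (x ∷ ρ) (x′ ∷ ρ′))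
  ×-dec (0 ℕ.<? a →-dec Fin.all? λ x′ → Fin.any? λ x → dup? r (pred a) a G G′ (x ∷ ρ) (x′ ∷ ρ′))

-- A free variable is required so that the empty conjunction and disjunction can be written without
-- quantifiers.
⋀ ⋁ : (Fin n → Formula (suc k)) → Formula (suc k)
⋀ {zero}  Φ = zero =′ zero
⋀ {suc n} Φ = Φ zero ∧′ ⋀ (Φ ∘ suc)
⋁ {zero}  Φ = ¬′ (zero =′ zero)
⋁ {suc n} Φ = Φ zero ∨′ ⋁ (Φ ∘ suc)

module _ {P : List Quantifier → Set} (P[] : P []) where

  nest-⋀ : (Φ : Fin n → Formula (suc k)) → (∀ i → All P (Nest (Φ i))) → All P (Nest (⋀ Φ))
  nest-⋀ {zero}  Φ ps = P[] ∷ []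
  nest-⋀ {suc n} Φ ps = All.++⁺ (ps zero) (nest-⋀ (Φ ∘ suc) (ps ∘ suc))

  nest-⋁ : (Φ : Fin n → Formula (suc k)) → (∀ i → All P (Nest (Φ i))) → All P (Nest (⋁ Φ))
  nest-⋁ {zero}  Φ ps = P[] ∷ []
  nest-⋁ {suc n} Φ ps = All.++⁺ (ps zero) (nest-⋁ (Φ ∘ suc) (ps ∘ suc))

module _ {G : Graph m} {ρ : Vec (Fin m) (suc k)} where

  ⋀-intro : (Φ : Fin n → Formula (suc k)) → (∀ i → G , ρ ⊨ Φ i) → G , ρ ⊨ ⋀ Φ
  ⋀-intro {zero}  Φ p = refl
  ⋀-intro {suc n} Φ p = p zero , ⋀-intro (Φ ∘ suc) (p ∘ suc)

  ⋀-elim : (Φ : Fin n → Formula (suc k)) → G , ρ ⊨ ⋀ Φ → ∀ i → G , ρ ⊨ Φ i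
  ⋀-elim {suc n} Φ (p , q) zero    = p
  ⋀-elim {suc n} Φ (p , q) (suc i) = ⋀-elim (Φ ∘ suc) q i

  ⋁-intro : (Φ : Fin n → Formula (suc k)) → ∀ i → G , ρ ⊨ Φ i → G , ρ ⊨ ⋁ Φ
  ⋁-intro {suc n} Φ zero    p = inj₁ p
  ⋁-intro {suc n} Φ (suc i) p = inj₂ (⋁-intro (Φ ∘ suc) i p)

  ⋁-elim : (Φ : Fin n → Formula (suc k)) → G , ρ ⊨ ⋁ Φ → ∃[ i ] G , ρ ⊨ Φ i
  ⋁-elim {zero}  Φ ¬p       = contradiction refl ¬p
  ⋁-elim {suc n} Φ (inj₁ p) = zero , p
  ⋁-elim {suc n} Φ (inj₂ p) = let i , q = ⋁-elim (Φ ∘ suc) p in suc i , q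

record Separated (P : List Quantifier → Set) (G : Graph m) (G′ : Graph n)
                 (ρ : Vec (Fin m) k) (ρ′ : Vec (Fin n) k) : Set where
  constructor separated
  field
    formula : Formula k
    nest    : All P (Nest formula)
    holds   : G , ρ ⊨ formula
    fails   : ¬ (G′ , ρ′ ⊨ formula)

open Separated

separate-does : {P : List Quantifier → Set} → P [] →
  {G : Graph m} {G′ : Graph n} {ρ : Vec (Fin m) k} {ρ′ : Vec (Fin n) k} (Φ : Formula k) →
  Nest Φ ≡ [] ∷ [] → (Φ? : Dec (G , ρ ⊨ Φ)) (Φ′? : Dec (G′ , ρ′ ⊨ Φ)) →
  does Φ? ≢ does Φ′? → Separated P G G′ ρ ρ′
separate-does P[] Φ nest (yes p) (yes q) ne = contradiction refl ne
separate-does P[] Φ nest (yes p) (no q)  ne =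
  separated Φ (subst (All _) (sym nest) (P[] ∷ [])) p q
separate-does P[] Φ nest (no p)  (yes q) ne =
  separated (¬′ Φ) (subst (All _ ∘ mapₗ (mapₗ dual)) (sym nest) (P[] ∷ [])) p (λ ¬q → ¬q q)
separate-does P[] Φ nest (no p)  (no q)  ne = contradiction refl ne

separate-same : {P : List Quantifier → Set} → P [] →
  (G : Graph m) (G′ : Graph n) (ρ : Vec (Fin m) k) (ρ′ : Vec (Fin n) k) →
  ¬ Same G G′ ρ ρ′ → Separated P G G′ ρ ρ′
separate-same P[] G G′ ρ ρ′ ¬s
  with i , ¬sᵢ ← Fin.¬∀⟶∃¬ _ _ (λ i → Fin.all? λ j → link G _ _ ≟ₗ link G′ _ _) (¬s ∘ same-links)
  with j , ¬sᵢⱼ ← Fin.¬∀⟶∃¬ _ _ (λ j → link G _ _ ≟ₗ link G′ _ _) ¬sᵢ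
  with does (lookup ρ i Fin.≟ lookup ρ j) Bool.≟ does (lookup ρ′ i Fin.≟ lookup ρ′ j)
... | no ne  = separate-does P[] (i =′ j) refl
                 (_ Fin.≟ _) (_ Fin.≟ _) ne
... | yes eq = separate-does P[] (E′ i j) refl
                 (Graph.adj? G _ _) (Graph.adj? G′ _ _) (λ eq′ → ¬sᵢⱼ (cong₂ _,_ eq eq′))

-- A winning move of Spoiler in `G` becomes `∃′` over the conjunction of formulas refuting the
-- finitely many replies; one in `G′` becomes `∀′` over a disjunction. If there is neither,
-- Duplicator can answer every move.
dup-complete : ∀ r e a (G : Graph m) (G′ : Graph n) (ρ : Vec _ k) ρ′ →
               ¬ Dup r e a G G′ ρ ρ′ → Separated (Fits r e a) G G′ ρ ρ′
dup-complete zero e a G G′ ρ ρ′ ¬d = separate-same tt G G′ ρ ρ′ ¬d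
dup-complete (suc r) e a G G′ ρ ρ′ ¬d with same? G G′ ρ ρ′
... | no ¬s = separate-same tt G G′ ρ ρ′ ¬s
... | yes s with Fin.any? (λ x → 0 ℕ.<? e ×-dec Fin.all? (λ x′ →
                   ¬? (dup? r e (pred e) G G′ (x ∷ ρ) (x′ ∷ ρ′))))
... | yes (x , 0<e , f) =
  let sep = λ x′ → dup-complete r e (pred e) G G′ (x ∷ ρ) (x′ ∷ ρ′) (f x′)
      Φ   = λ x′ → formula (sep x′)
  in separated (∃′ ⋀ Φ)
       (All.map⁺ (All.map (0<e ,_) (nest-⋀ tt Φ (λ x′ → nest (sep x′)))))
       (x , ⋀-intro Φ (λ x′ → holds (sep x′)))
       (λ (x′ , p) → fails (sep x′) (⋀-elim Φ p x′))
... | no ¬f with Fin.any? (λ x′ → 0 ℕ.<? a ×-dec Fin.all? (λ x →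
                   ¬? (dup? r (pred a) a G G′ (x ∷ ρ) (x′ ∷ ρ′))))
... | yes (x′ , 0<a , g) =
  let sep = λ x → dup-complete r (pred a) a G G′ (x ∷ ρ) (x′ ∷ ρ′) (g x)
      Φ   = λ x → formula (sep x)
  in separated (∀′ ⋁ Φ)
       (All.map⁺ (All.map (0<a ,_) (nest-⋁ tt Φ (λ x → nest (sep x)))))
       (λ x → ⋁-intro Φ x (holds (sep x)))
       (λ p → let x , q = ⋁-elim Φ (p x′) in fails (sep x) q)
... | no ¬g = contradiction
  ( s
  , (λ 0<e x → decidable-stable (Fin.any? λ x′ → dup? r e (pred e) G G′ (x ∷ ρ) (x′ ∷ ρ′))
      λ ¬p → ¬f (x , 0<e , λ x′ d → ¬p (x′ , d)))
  , (λ 0<a x′ → decidable-stable (Fin.any? λ x → dup? r (pred a) a G G′ (x ∷ ρ) (x′ ∷ ρ′))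
      λ ¬p → ¬g (x′ , 0<a , λ x d → ¬p (x , d)))) ¬d

-- Quantifier words, budgets and the value of D

fits-length : ∀ r {e a} w → Fits r e a w → length w ≤ r
fits-length r       []        _       = z≤n
fits-length (suc r) (ex ∷ w)  (_ , f) = s≤s (fits-length r w f)
fits-length (suc r) (all ∷ w) (_ , f) = s≤s (fits-length r w f)

budget : (e a : ℕ) → Quantifier → ℕ
budget e a ex  = e
budget e a all = a

-- After a letter, the opposite letter has a budget smaller by one, so each alternation uses up one
-- unit and the last letter still needs a positive budget.
fits-alternations : ∀ r {e a} q w → Fits r e a (q ∷ w) → alternations (q ∷ w) < budget e a q
fits-alternations (suc r)     ex  []        (p , _) = p
fits-alternations (suc r)     ex  (ex ∷ w)  (_ , f) = fits-alternations r ex w f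
fits-alternations (suc r) {e = suc e} ex  (all ∷ w) (_ , f) = s≤s (fits-alternations r all w f)
fits-alternations (suc r)     all []        (p , _) = p
fits-alternations (suc r) {a = suc a} all (ex ∷ w)  (_ , f) = s≤s (fits-alternations r ex w f)
fits-alternations (suc r)     all (all ∷ w) (_ , f) = fits-alternations r all w f

alternations-fits : ∀ r {e a} q w → length (q ∷ w) ≤ r →
                    alternations (q ∷ w) < budget e a q → Fits r e a (q ∷ w)
alternations-fits (suc r) ex []        l p = p , tt
alternations-fits (suc r) ex (ex ∷ w)  l p =
  ℕ.≤-<-trans z≤n p , alternations-fits r ex w (s≤s⁻¹ l) p
alternations-fits (suc r) {suc e} ex (all ∷ w) l p =
  s≤s z≤n , alternations-fits r all w (s≤s⁻¹ l) (s≤s⁻¹ p)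
alternations-fits (suc r) all []        l p = p , tt
alternations-fits (suc r) {a = suc a} all (ex ∷ w)  l p =
  s≤s z≤n , alternations-fits r ex w (s≤s⁻¹ l) (s≤s⁻¹ p)
alternations-fits (suc r) all (all ∷ w) l p =
  ℕ.≤-<-trans z≤n p , alternations-fits r all w (s≤s⁻¹ l) p

fits₂₂-alternations : ∀ r w → Fits r 2 2 w → alternations w ≤ 1
fits₂₂-alternations r []        f = z≤n
fits₂₂-alternations r (ex ∷ w)  f = s≤s⁻¹ (fits-alternations r ex w f)
fits₂₂-alternations r (all ∷ w) f = s≤s⁻¹ (fits-alternations r all w f)

alternations-fits₂₂ : ∀ r w → length w ≤ r → alternations w ≤ 1 → Fits r 2 2 w
alternations-fits₂₂ r []        l p = tt
alternations-fits₂₂ r (ex ∷ w)  l p = alternations-fits r ex w l (s≤s p)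
alternations-fits₂₂ r (all ∷ w) l p = alternations-fits r all w l (s≤s p)

nest-fits : ∀ r (Φ : Formula k) → quantifierRank Φ ≤ r → alternationNumber Φ ≤ 1 →
            All (Fits r 2 2) (Nest Φ)
nest-fits r Φ rank≤r alt≤1 = All.tabulate λ {w} w∈ → alternations-fits₂₂ r w
  (ℕ.≤-trans (All.lookup (All.map⁻ (xs≤max 0 (mapₗ length (Nest Φ)))) w∈) rank≤r)
  (ℕ.≤-trans (All.lookup (All.map⁻ (xs≤max 0 (mapₗ alternations (Nest Φ)))) w∈) alt≤1)

fits-rank : ∀ r (Φ : Formula k) → All (Fits r 2 2) (Nest Φ) → quantifierRank Φ ≤ r
fits-rank r Φ fs = max≤v⁺ z≤n (All.map⁺ (All.map (λ {w} → fits-length r w) fs))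

fits-alternationNumber : ∀ r (Φ : Formula k) → All (Fits r 2 2) (Nest Φ) → alternationNumber Φ ≤ 1
fits-alternationNumber r Φ fs =
  max≤v⁺ z≤n (All.map⁺ (All.map (λ {w} → fits₂₂-alternations r w) fs))

-- Descend until one round fewer no longer suffices for Spoiler. The formula of `dup-complete` then
-- has at most this rank, and `dup-sound` excludes a smaller one.
D-bound : ∀ (G : Graph m) (G′ : Graph n) N →
          ¬ Dup N 2 2 G G′ [] [] → ∃[ d ] (D 1 G G′ d × d ≤ N)
D-bound G G′ zero ¬dup =
  let separated Φ fs p q = dup-complete 0 2 2 G G′ [] [] ¬dup in
  0 , record
    { attained = Φ , fits-alternationNumber 0 Φ fs , (p , q) , ℕ.n≤0⇒n≡0 (fits-rank 0 Φ fs)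
    ; minimal  = λ _ _ _ → z≤n } , ℕ.≤-refl
D-bound G G′ (suc N) ¬dup with dup? N 2 2 G G′ [] []
... | no ¬dup′ = let d , D-d , d≤N = D-bound G G′ N ¬dup′ in d , D-d , ℕ.m≤n⇒m≤1+n d≤N
... | yes dup  =
  let separated Φ fs p q = dup-complete (suc N) 2 2 G G′ [] [] ¬dup
      minimal : ∀ Ψ → alternationNumber Ψ ≤ 1 → Distinguishes Ψ G G′ → suc N ≤ quantifierRank Ψ
      minimal Ψ alt (p , q) = ℕ.≰⇒> λ rank → q (dup-sound Ψ (nest-fits N Ψ rank alt) dup p)
      alt = fits-alternationNumber (suc N) Φ fs
  in suc N , record
    { attained = Φ , alt , (p , q) ,
                 ℕ.≤-antisym (fits-rank (suc N) Φ fs) (minimal Φ alt (p , q))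
    ; minimal  = minimal } , ℕ.≤-refl

-- Counting along fibres

lookup-injective : {xs : List A} → Unique xs → ∀ i j →
                   List.lookup xs i ≡ List.lookup xs j → i ≡ j
lookup-injective (_ ∷ _)   zero    zero    _  = refl
lookup-injective (x∉ ∷ _)  zero    (suc j) eq = contradiction eq (All.lookup x∉ (∈-lookup j))
lookup-injective (x∉ ∷ _)  (suc i) zero    eq = contradiction (sym eq) (All.lookup x∉ (∈-lookup i))
lookup-injective (_ ∷ xs!) (suc i) (suc j) eq = cong suc (lookup-injective xs! i j eq)

unique-⊆⇒length≤ : {xs ys : List A} → Unique xs → xs ⊆ ys → length xs ≤ length ys
unique-⊆⇒length≤ xs! xs⊆ys = Fin.injective⇒≤ {f = λ i → index (xs⊆ys (∈-lookup i))} λ {i} {j} eq →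
  lookup-injective xs! i j
    (index-injective (setoid _) (xs⊆ys (∈-lookup i)) (xs⊆ys (∈-lookup j)) eq)

length-filter-split : {P : A → Set} (P? : Decidable P) (xs : List A) →
                      length (filter P? xs) + length (filter (¬? ∘ P?) xs) ≡ length xs
length-filter-split P? []       = refl
length-filter-split P? (x ∷ xs) with P? x
... | yes _ = cong suc (length-filter-split P? xs)
... | no _  = trans (ℕ.+-suc _ _) (cong suc (length-filter-split P? xs))

injection⇒surjective : {π : Fin n → Fin n} → Injective _≡_ _≡_ π → ∀ y → ∃[ x ] π x ≡ y
injection⇒surjective {n = suc n} {π} π-inj y with Fin.any? (λ x → π x Fin.≟ y)
... | yes hit = hit
... | no miss = contradiction
  (Fin.injective⇒≤ {f = λ x → punchOut (missed x)}
    λ {x} {z} → π-inj ∘ Fin.punchOut-injective (missed x) (missed z))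
  ℕ.1+n≰n
  where
  missed : ∀ x → y ≢ π x
  missed x eq = miss (x , sym eq)

injection⇒↔ : {π : Fin n → Fin n} → Injective _≡_ _≡_ π → Fin n ↔ Fin n
injection⇒↔ {π = π} π-inj = mk↔ₛ′ π (proj₁ ∘ sur) (proj₂ ∘ sur) (π-inj ∘ proj₂ ∘ sur ∘ π)
  where sur = injection⇒surjective π-inj

-- The i-th entry of `l a` goes to the i-th entry of `l′ a`. Entries for different labels differ in
-- `t′`, so the pieces glue to one injection.
fibrewise-injection :
  (t : U → A) (t′ : W → A) (l : A → List U) (l′ : A → List W) →
  (∀ v → v ∈ l (t v)) → (∀ {a w} → w ∈ l′ a → t′ w ≡ a) → (∀ a → Unique (l′ a)) →
  (∀ a → length (l a) ≤ length (l′ a)) →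
  ∃[ π ] (Injective _≡_ _≡_ π × ∀ v → t′ (π v) ≡ t v)
fibrewise-injection {U = U} {W = W} t t′ l l′ v∈ ∈⇒t′ l′! l≤l′ = π , π-injective , t′π
  where
  place : ∀ a {v} → v ∈ l a → Fin (length (l′ a))
  place a p = inject≤ (index p) (l≤l′ a)

  π : U → W
  π v = List.lookup (l′ (t v)) (place (t v) (v∈ v))

  t′π : ∀ v → t′ (π v) ≡ t v
  t′π v = ∈⇒t′ (∈-lookup (place (t v) (v∈ v)))

  place-injective : ∀ a b {v w} (p : v ∈ l a) (q : w ∈ l b) → a ≡ b →
    List.lookup (l′ a) (place a p) ≡ List.lookup (l′ b) (place b q) → v ≡ w
  place-injective a .a p q refl eq = index-injective (setoid _) p q
    (Fin.inject≤-injective (l≤l′ a) (l≤l′ a) _ _ (lookup-injective (l′! a) _ _ eq))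

  π-injective : Injective _≡_ _≡_ π
  π-injective {v} {w} eq = place-injective (t v) (t w) (v∈ v) (v∈ w)
    (trans (sym (t′π v)) (trans (cong t′ eq) (t′π w))) eq

module Fibres (_≟_ : DecidableEquality A) where

  fibre rest : (U → A) → A → List U → List U
  fibre f a = filter (λ v → f v ≟ a)
  rest  f a = filter (λ v → ¬? (f v ≟ a))

  fibre+rest : (f : U → A) (a : A) (xs : List U) →
               length (fibre f a xs) + length (rest f a xs) ≡ length xs
  fibre+rest f a = length-filter-split (λ v → f v ≟ a)

  fibre-rest : (f : U → A) {a b : A} → b ≢ a → (xs : List U) →
               fibre f b (rest f a xs) ≡ fibre f b xs
  fibre-rest f b≢a []       = refl
  fibre-rest f {a} {b} b≢a (x ∷ xs) with f x ≟ a
  fibre-rest f {a} {b} b≢a (x ∷ xs) | yes fx≡a with f x ≟ b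
  ... | yes fx≡b = contradiction (trans (sym fx≡b) fx≡a) b≢a
  ... | no _     = fibre-rest f b≢a xs
  fibre-rest f {a} {b} b≢a (x ∷ xs) | no _ with f x ≟ b
  ... | yes _    = cong (x ∷_) (fibre-rest f b≢a xs)
  ... | no _     = fibre-rest f b≢a xs

  fibre-rest-self : (f : U → A) (a : A) (xs : List U) → fibre f a (rest f a xs) ≡ []
  fibre-rest-self f a []       = refl
  fibre-rest-self f a (x ∷ xs) with f x ≟ a
  ... | yes _ = fibre-rest-self f a xs
  ... | no fx≢a with f x ≟ a
  ... | yes fx≡a = contradiction fx≡a fx≢a
  ... | no _     = fibre-rest-self f a xs

  two-fibres : (f : U → A) {a b : A} → b ≢ a → (xs : List U) →
               length (fibre f a xs) + length (fibre f b xs) ≤ length xs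
  two-fibres f {a} {b} b≢a xs = begin
    length (fibre f a xs) + length (fibre f b xs)
      ≡⟨ cong (λ l → length (fibre f a xs) + length l) (fibre-rest f b≢a xs) ⟨
    length (fibre f a xs) + length (fibre f b (rest f a xs))
      ≤⟨ ℕ.+-monoʳ-≤ _ (length-filter (λ v → f v ≟ b) (rest f a xs)) ⟩
    length (fibre f a xs) + length (rest f a xs)
      ≡⟨ fibre+rest f a xs ⟩
    length xs ∎
    where open ℕ.≤-Reasoning

  module _ (f : U → A) (f′ : W → A) where

    Surplus : List U → List W → Set
    Surplus xs ys = ∃[ a ] length (fibre f a xs) < length (fibre f′ a ys)

    rest-surplus : ∀ a xs ys → Surplus (rest f a xs) (rest f′ a ys) → Surplus xs ys
    rest-surplus a xs ys (b , lt) with b ≟ a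
    ... | yes refl = contradiction
      (subst (_ <_) (cong length (fibre-rest-self f′ a ys)) lt) λ ()
    ... | no b≢a   = b , subst₂ _<_ (cong length (fibre-rest f b≢a xs))
                                    (cong length (fibre-rest f′ b≢a ys)) lt

    rest-shorter : ∀ a xs ys → length (fibre f′ a ys) ≤ length (fibre f a xs) →
                   length xs < length ys → length (rest f a xs) < length (rest f′ a ys)
    rest-shorter a xs ys fib xs<ys = ℕ.+-cancelˡ-< (length (fibre f a xs)) _ _ (begin-strict
      length (fibre f a xs) + length (rest f a xs)   ≡⟨ fibre+rest f a xs ⟩
      length xs                                      <⟨ xs<ys ⟩
      length ys                                      ≡⟨ fibre+rest f′ a ys ⟨
      length (fibre f′ a ys) + length (rest f′ a ys) ≤⟨ ℕ.+-monoˡ-≤ _ fib ⟩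
      length (fibre f a xs) + length (rest f′ a ys)  ∎)
      where open ℕ.≤-Reasoning

    -- If the fibre of the head of `ys` shows no surplus, deleting it from both lists keeps `xs` the
    -- shorter one. The head itself disappears, so `bound` decreases.
    shorter⇒surplus : ∀ bound xs ys → length ys ≤ bound → length xs < length ys → Surplus xs ys
    shorter⇒surplus (suc bound) xs (y ∷ ys) (s≤s ys≤bound) xs<ys
      with length (fibre f (f′ y) xs) ℕ.<? length (fibre f′ (f′ y) (y ∷ ys))
    ... | yes lt = f′ y , lt
    ... | no ≮   = rest-surplus (f′ y) xs (y ∷ ys)
      (shorter⇒surplus bound (rest f (f′ y) xs) (rest f′ (f′ y) (y ∷ ys)) rest≤bound
        (rest-shorter (f′ y) xs (y ∷ ys) (ℕ.≮⇒≥ ≮) xs<ys))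
      where
      rest≤bound : length (rest f′ (f′ y) (y ∷ ys)) ≤ bound
      rest≤bound with f′ y ≟ f′ y
      ... | yes _ = ℕ.≤-trans (length-filter _ ys) ys≤bound
      ... | no ≢  = contradiction refl ≢

    -- Once the deficient fibre is removed from both lists, what remains of `xs` is strictly shorter
    -- than what remains of `ys`.
    deficit⇒surplus : ∀ a xs ys → length xs ≤ length ys →
                      length (fibre f′ a ys) < length (fibre f a xs) → Surplus xs ys
    deficit⇒surplus a xs ys xs≤ys lt = rest-surplus a xs ys
      (shorter⇒surplus _ (rest f a xs) (rest f′ a ys) ℕ.≤-refl
      (ℕ.+-cancelˡ-< (length (fibre f′ a ys)) _ _ (begin-strict
        length (fibre f′ a ys) + length (rest f a xs)  <⟨ ℕ.+-monoˡ-< _ lt ⟩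
        length (fibre f a xs) + length (rest f a xs)   ≡⟨ fibre+rest f a xs ⟩
        length xs                                      ≤⟨ xs≤ys ⟩
        length ys                                      ≡⟨ fibre+rest f′ a ys ⟨
        length (fibre f′ a ys) + length (rest f′ a ys) ∎)))
      where open ℕ.≤-Reasoning

-- Types over a set of vertices

adj : Graph n → Fin n → Fin n → Bool
adj G x y = does (Graph.adj? G x y)

adj-sym : (G : Graph n) → ∀ x y → adj G x y ≡ adj G y x
adj-sym G x y = does-⇔ (mk⇔ (Graph.sym G) (Graph.sym G)) (Graph.adj? G x y) (Graph.adj? G y x)

-- The links contain equality, so a member of X has a type of its own.
tp : Graph n → Vec (Fin n) k → Fin n → Vec Link k
tp G X v = Vec.map (link G v) X

infix 4 _≟ₜ_

_≟ₜ_ : DecidableEquality (Vec Link k)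
_≟ₜ_ = ≡-dec _≟ₗ_

tp-cong : (G : Graph m) (G′ : Graph n) (X : Vec (Fin m) k) (X′ : Vec (Fin n) k) {x : Fin m} {x′ : Fin n} →
          (∀ i → link G x (lookup X i) ≡ link G′ x′ (lookup X′ i)) → tp G X x ≡ tp G′ X′ x′
tp-cong G G′ []      []        eq = refl
tp-cong G G′ (_ ∷ X) (_ ∷ X′) eq = cong₂ _∷_ (eq zero) (tp-cong G G′ X X′ (eq ∘ suc))

Mate : Graph n → Vec (Fin n) k → Fin n → Set
Mate G X u = ∃[ w ] (w ≢ u × tp G X w ≡ tp G X u)

-- `a` and `b` may lie in the class of `u`, so each class of two or more vertices is a clique or an
-- independent set.
Homogeneous : Graph n → Vec (Fin n) k → Set
Homogeneous G X = ∀ u → Mate G X u → ∀ a b → a ≢ u → b ≢ u →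
                  tp G X a ≡ tp G X b → adj G u a ≡ adj G u b

Spread : Graph n → Vec (Fin n) k → List (Fin n) → Set
Spread G X = AllPairs (λ v w → tp G X v ≢ tp G X w)

-- The bound on R amounts to |X| + 1 classes outside X, since each member of X is
-- a class by itself.
record Base (G : Graph n) : Set where
  constructor base
  field
    size        : ℕ
    X           : Vec (Fin n) size
    R           : List (Fin n)
    spread      : Spread G X R
    large       : suc (size + size) ≤ length R
    homogeneous : Homogeneous G X

mate? : (G : Graph n) (X : Vec (Fin n) k) → ∀ u → Dec (Mate G X u)
mate? G X u = Fin.any? λ w → ¬? (w Fin.≟ u) ×-dec tp G X w ≟ₜ tp G X u

-- The members of `R` have distinct types. The list `τs` lets whole classes count once each, and `Q`
-- holds the vertices left over.
spread-bound : (G : Graph n) (X : Vec (Fin n) k) (R : List (Fin n)) → Spread G X R →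
               (τs : List (Vec Link k)) (Q : List (Fin n)) →
               (∀ v → tp G X v ∈ τs ++ₗ mapₗ (tp G X) Q) → length R ≤ length τs + length Q
spread-bound G X R R! τs Q cover = begin
  length R                              ≡⟨ length-map (tp G X) R ⟨
  length (mapₗ (tp G X) R)              ≤⟨ unique-⊆⇒length≤ (AllPairs.map⁺ R!) ⊆cover ⟩
  length (τs ++ₗ mapₗ (tp G X) Q)        ≡⟨ length-++ τs ⟩
  length τs + length (mapₗ (tp G X) Q)  ≡⟨ cong (length τs +_) (length-map (tp G X) Q) ⟩
  length τs + length Q                  ∎
  where
  open ℕ.≤-Reasoning
  ⊆cover : ∀ {τ} → τ ∈ mapₗ (tp G X) R → τ ∈ τs ++ₗ mapₗ (tp G X) Q
  ⊆cover p = let v , _ , eq = ∈-map⁻ (tp G X) p in subst (_∈ _) (sym eq) (cover v)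

length-allFin : ∀ n → length (allFin n) ≡ n
length-allFin n = length-tabulate (λ i → i)

module Types {k} = Fibres (_≟ₜ_ {k})
open Types using (fibre; rest; fibre+rest; fibre-rest)

module _ (G : Graph n) (X : Vec (Fin n) k) (R : List (Fin n)) (R! : Spread G X R) where

  private
    T : Fin n → Vec Link k
    T = tp G X
    V : List (Fin n)
    V = allFin n

    ∈-rest : ∀ {τ v xs} → T v ≢ τ → v ∈ xs → v ∈ rest T τ xs
    ∈-rest ≢τ v∈ = ∈-filter⁺ (λ v → ¬? (T v ≟ₜ _)) v∈ ≢τ

  spread-length : length R ≤ n
  spread-length = ℕ.≤-trans (spread-bound G X R R! [] V λ v → ∈-map⁺ T (∈-allFin v))
                            (ℕ.≤-reflexive (length-allFin n))

  -- The class of `τ` accounts for one type, and each vertex outside it for at most one more.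
  spread-class : ∀ τ → length R + length (fibre T τ V) ≤ n + 1
  spread-class τ = begin
    length R + c    ≤⟨ ℕ.+-monoˡ-≤ c (spread-bound G X R R! (τ ∷ []) (rest T τ V) cover) ⟩
    1 + q + c       ≡⟨ rearrange q c ⟩
    (c + q) + 1     ≡⟨ cong (_+ 1) (trans (fibre+rest T τ V) (length-allFin n)) ⟩
    n + 1           ∎
    where
    open ℕ.≤-Reasoning
    c = length (fibre T τ V)
    q = length (rest T τ V)
    cover : ∀ v → T v ∈ (τ ∷ []) ++ₗ mapₗ T (rest T τ V)
    cover v with T v ≟ₜ τ
    ... | yes eq = here eq
    ... | no ≢τ  = there (∈-map⁺ T (∈-rest ≢τ (∈-allFin v)))
    rearrange : ∀ q c → 1 + q + c ≡ (c + q) + 1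
    rearrange = solve-∀

  spread-two-classes : ∀ {τ σ} → σ ≢ τ →
                       length R + (length (fibre T τ V) + length (fibre T σ V)) ≤ n + 2
  spread-two-classes {τ} {σ} σ≢τ = begin
    length R + (c + d)          ≤⟨ ℕ.+-monoˡ-≤ (c + d) (spread-bound G X R R! (τ ∷ σ ∷ []) Q cover) ⟩
    2 + q + (c + d)             ≡⟨ rearrange q c d ⟩
    c + (d + q) + 2             ≡⟨ cong (λ l → c + l + 2) d+q ⟩
    c + length (rest T τ V) + 2 ≡⟨ cong (_+ 2) (trans (fibre+rest T τ V) (length-allFin n)) ⟩
    n + 2                       ∎
    where
    open ℕ.≤-Reasoning
    Q = rest T σ (rest T τ V)
    c = length (fibre T τ V)
    d = length (fibre T σ V)
    q = length Q
    d+q : d + q ≡ length (rest T τ V)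
    d+q = trans (cong (λ l → length l + q) (sym (fibre-rest T σ≢τ V)))
                (fibre+rest T σ (rest T τ V))
    cover : ∀ v → T v ∈ (τ ∷ σ ∷ []) ++ₗ mapₗ T Q
    cover v with T v ≟ₜ τ | T v ≟ₜ σ
    ... | yes eq | _      = here eq
    ... | no _   | yes eq = there (here eq)
    ... | no ≢τ  | no ≢σ  = there (there (∈-map⁺ T (∈-rest ≢σ (∈-rest ≢τ (∈-allFin v)))))
    rearrange : ∀ q c d → 2 + q + (c + d) ≡ c + (d + q) + 2
    rearrange = solve-∀

-- If u lies in a class of two or more and splits the class of a and b, then u and
-- b are new representatives over u ∷ X, once a represents its class and u has
-- been replaced by the mate w.
module Split (G : Graph n) (X : Vec (Fin n) k) {u w a b : Fin n}
  (w≢u : w ≢ u) (w~u : tp G X w ≡ tp G X u) (a≢u : a ≢ u) (b≢u : b ≢ u)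
  (a~b : tp G X a ≡ tp G X b) (split : adj G u a ≢ adj G u b) where

  move : Fin n → Fin n
  move v with tp G X v ≟ₜ tp G X a | v Fin.≟ u
  ... | yes _ | _     = a
  ... | no _  | yes _ = w
  ... | no _  | no _  = v

  tp-move : ∀ v → tp G X (move v) ≡ tp G X v
  tp-move v with tp G X v ≟ₜ tp G X a | v Fin.≟ u
  ... | yes eq | _        = sym eq
  ... | no _   | yes refl = w~u
  ... | no _   | no _     = refl

  move≢u : ∀ v → move v ≢ u
  move≢u v with tp G X v ≟ₜ tp G X a | v Fin.≟ u
  ... | yes _ | _      = a≢u
  ... | no _  | yes _  = w≢u
  ... | no _  | no v≢u = v≢u

  move-a : ∀ {v} → tp G X v ≡ tp G X a → move v ≡ a
  move-a {v} eq with tp G X v ≟ₜ tp G X a | v Fin.≟ u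
  ... | yes _ | _ = refl
  ... | no ≢  | _ = contradiction eq ≢

  T : Fin n → Vec Link (suc k)
  T = tp G (u ∷ X)

  head≡ : ∀ {x y} → T x ≡ T y → link G x u ≡ link G y u
  head≡ = proj₁ ∘ ∷-injective

  tail≡ : ∀ {x y} → T x ≡ T y → tp G X x ≡ tp G X y
  tail≡ = proj₂ ∘ ∷-injective

  apart : ∀ {y} → y ≢ u → T u ≢ T y
  apart y≢u eq = y≢u (link-≡ {G = G} {G} (head≡ eq) refl)

  -- A moved representative in the class of `b` over `X` can only be `a`, and adjacency to `u`
  -- separates `a` from `b`.
  b-apart : ∀ v → T b ≢ T (move v)
  b-apart v eq = split (trans (adj-sym G u a) (trans (sym b≡a) (adj-sym G b u)))
    where
    move≡a : move v ≡ a
    move≡a = move-a (trans (sym (tp-move v)) (trans (sym (tail≡ eq)) (sym a~b)))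
    b≡a : adj G b u ≡ adj G a u
    b≡a = trans (cong proj₂ (head≡ eq)) (cong (λ x → adj G x u) move≡a)

  spread-step : ∀ {R} → Spread G X R → Spread G (u ∷ X) (u ∷ b ∷ mapₗ move R)
  spread-step {R} R! =
    (apart b≢u ∷ All.map⁺ (All.tabulate λ {v} _ → apart (move≢u v))) ∷
    All.map⁺ (All.tabulate λ {v} _ → b-apart v) ∷
    AllPairs.map⁺ (AllPairs.map (λ {v} {w} ≢ eq →
      ≢ (trans (sym (tp-move v)) (trans (tail≡ eq) (tp-move w)))) R!)

-- Each split adds one vertex to `X` and two representatives to `R`, preserving `2k + 1 ≤ |R|`.
-- Since `|R| ≤ n`, `k` cannot reach `n`, so the recursion ends before `bound` is exhausted, with no
-- split left.
grow : (G : Graph n) (bound : ℕ) {k : ℕ} (X : Vec (Fin n) k) (R : List (Fin n)) → Spread G X R →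
       suc (k + k) ≤ length R → n ≤ k + bound → Base G
grow {n} G bound {k} X R R! large n≤
  with Fin.any? (λ u → Fin.any? λ w → Fin.any? λ a → Fin.any? λ b →
    ¬? (w Fin.≟ u) ×-dec tp G X w ≟ₜ tp G X u ×-dec ¬? (a Fin.≟ u) ×-dec ¬? (b Fin.≟ u)
    ×-dec tp G X a ≟ₜ tp G X b ×-dec ¬? (adj G u a Bool.≟ adj G u b))
... | no none = base k X R R! large λ u (w , w≢u , w~u) a b a≢u b≢u a~b →
  decidable-stable (adj G u a Bool.≟ adj G u b)
    λ ≢ → none (u , w , a , b , w≢u , w~u , a≢u , b≢u , a~b , ≢)
grow {n} G zero {k} X R R! large n≤ | yes _ = contradiction (begin-strict
  k               ≤⟨ ℕ.m≤m+n k k ⟩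
  k + k           <⟨ large ⟩
  length R        ≤⟨ spread-length G X R R! ⟩
  n               ≤⟨ n≤ ⟩
  k + 0           ≡⟨ ℕ.+-identityʳ k ⟩
  k               ∎) (ℕ.<-irrefl refl)
  where open ℕ.≤-Reasoning
grow {n} G (suc bound) {k} X R R! large n≤
  | yes (u , w , a , b , w≢u , w~u , a≢u , b≢u , a~b , split) =
  grow G bound (u ∷ X) (u ∷ b ∷ mapₗ S.move R) (S.spread-step R!)
    (subst₂ _≤_ (cong (2 +_) (sym (ℕ.+-suc k k))) (cong (2 +_) (sym (length-map S.move R)))
      (s≤s (s≤s large)))
    (subst (n ≤_) (ℕ.+-suc k bound) n≤)
  where module S = Split G X w≢u w~u a≢u b≢u a~b split

exists-base : (G : Graph (suc n)) → Base G
-- Over the empty set one vertex represents the only type, which meets the bound 2·0 + 1 exactly.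
exists-base {n} G = grow G (suc n) [] (zero ∷ []) ([] ∷ []) ℕ.≤-refl ℕ.≤-refl

-- Replace the endpoints one at a time, in an order for which the intermediate pair consists of
-- distinct vertices. If neither order works, the two pairs are reversals of each other.
homogeneous-pairs : (G : Graph n) (X : Vec (Fin n) k) → Homogeneous G X → ∀ {x y x₂ y₂} →
  Mate G X x → Mate G X y → x ≢ y → x₂ ≢ y₂ → tp G X x ≡ tp G X x₂ → tp G X y ≡ tp G X y₂ →
  adj G x y ≡ adj G x₂ y₂
homogeneous-pairs G X hom {x} {y} {x₂} {y₂} mx my x≢y x₂≢y₂ x~x₂ y~y₂ with x Fin.≟ y₂
... | no x≢y₂ = begin
  adj G x y   ≡⟨ hom x mx y y₂ (x≢y ∘ sym) (x≢y₂ ∘ sym) y~y₂ ⟩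
  adj G x y₂  ≡⟨ adj-sym G x y₂ ⟩
  adj G y₂ x  ≡⟨ hom y₂ (move-mate my y~y₂) x x₂ x≢y₂ x₂≢y₂ x~x₂ ⟩
  adj G y₂ x₂ ≡⟨ adj-sym G y₂ x₂ ⟩
  adj G x₂ y₂ ∎
  where
  open ≡-Reasoning
  move-mate : ∀ {u v} → Mate G X u → tp G X u ≡ tp G X v → Mate G X v
  move-mate {u} {v} m u~v with u Fin.≟ v
  ... | yes refl = m
  ... | no u≢v   = u , u≢v , u~v
... | yes refl with x₂ Fin.≟ y
... | yes refl = adj-sym G x y
... | no x₂≢y  = begin
  adj G x y  ≡⟨ adj-sym G x y ⟩
  adj G y x  ≡⟨ hom y my x x₂ x≢y x₂≢y x~x₂ ⟩
  adj G y x₂ ≡⟨ adj-sym G y x₂ ⟩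
  adj G x₂ y ≡⟨ hom x₂ (x , x₂≢y₂ ∘ sym , x~x₂) y x (x₂≢y ∘ sym) (x₂≢y₂ ∘ sym) y~y₂ ⟩
  adj G x₂ x ∎
  where open ≡-Reasoning

-- The game in which Spoiler stays in one graph

Surv : ℕ → (G : Graph m) (G′ : Graph n) → Vec (Fin m) k → Vec (Fin n) k → Set
Surv zero    G G′ ρ ρ′ = Same G G′ ρ ρ′
Surv (suc r) G G′ ρ ρ′ = Same G G′ ρ ρ′ × ∀ x → ∃[ x′ ] Surv r G G′ (x ∷ ρ) (x′ ∷ ρ′)

dup⇒surv : ∀ r {e a} {G : Graph m} {G′ : Graph n} {ρ : Vec _ k} {ρ′} → 0 < e →
           Dup r e a G G′ ρ ρ′ → Surv r G G′ ρ ρ′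
dup⇒surv zero    0<e s           = s
dup⇒surv (suc r) 0<e (s , f , _) = s , λ x → let x′ , d = f 0<e x in x′ , dup⇒surv r 0<e d

-- After opening with `xs` in `G`, Spoiler may still stay there or cross once to `G′`.
dup-play : (G : Graph m) (G′ : Graph n) (xs : Vec (Fin m) k) → ∀ r → Dup (k + r) 2 2 G G′ [] [] →
           ∃₂ λ xs′ a → 0 < a × Dup r 2 a G G′ xs xs′
dup-play G G′ []       r d = [] , 2 , s≤s z≤n , d
dup-play {k = suc k} G G′ (x ∷ xs) r d =
  let xs′ , _ , _ , _ , f , _ =
        dup-play G G′ xs (suc r) (subst (λ s → Dup s 2 2 G G′ [] []) (sym (ℕ.+-suc k r)) d)
      x′ , d′ = f (s≤s z≤n) x
  in x′ ∷ xs′ , 1 , s≤s z≤n , d′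

module _ {G : Graph m} {G′ : Graph n} where

  surv-same : ∀ r {ρ : Vec (Fin m) k} {ρ′} → Surv r G G′ ρ ρ′ → Same G G′ ρ ρ′
  surv-same zero    s       = s
  surv-same (suc r) (s , _) = s

  surv-≤ : ∀ {i j} {ρ : Vec (Fin m) k} {ρ′} → i ≤ j → Surv j G G′ ρ ρ′ → Surv i G G′ ρ ρ′
  surv-≤ {j = j} z≤n     d       = surv-same j d
  surv-≤         (s≤s p) (s , f) = s , λ x → let x′ , d = f x in x′ , surv-≤ p d

  Selects : ∀ {k k₁} → Vec (Fin m) k → Vec (Fin n) k → Vec (Fin m) k₁ → Vec (Fin n) k₁ → Set
  Selects ρ ρ′ σ σ′ = ∀ i → ∃[ j ] (lookup σ j ≡ lookup ρ i × lookup σ′ j ≡ lookup ρ′ i)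

  same-select : ∀ {k k₁} {ρ : Vec (Fin m) k} {ρ′} {σ : Vec (Fin m) k₁} {σ′} →
                Selects ρ ρ′ σ σ′ → Same G G′ σ σ′ → Same G G′ ρ ρ′
  same-select sel s = same-links λ i j →
    let i₁ , p , p′ = sel i ; j₁ , q , q′ = sel j
    in trans (sym (cong₂ (link G) p q)) (trans (link≡ s i₁ j₁) (cong₂ (link G′) p′ q′))

  surv-select : ∀ r {k k₁} {ρ : Vec (Fin m) k} {ρ′} {σ : Vec (Fin m) k₁} {σ′} →
                Selects ρ ρ′ σ σ′ → Surv r G G′ σ σ′ → Surv r G G′ ρ ρ′
  surv-select zero    sel s       = same-select sel s
  surv-select (suc r) sel (s , f) = same-select sel s , λ x →
    let x′ , d = f x in x′ , surv-select r (λ where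
      zero    → zero , refl , refl
      (suc i) → let j , p = sel i in suc j , p) d

  surv-play : ∀ r {m′} {ρ : Vec (Fin m) k} {ρ′} (xs : Vec (Fin m) m′) →
              Surv (m′ + r) G G′ ρ ρ′ → ∃[ xs′ ] Surv r G G′ (xs ++ ρ) (xs′ ++ ρ′)
  surv-play r []       d = [] , d
  surv-play r {m′ = suc m′} {ρ} {ρ′} (x ∷ xs) d =
    let xs′ , _ , f = surv-play (suc r) xs (subst (λ s → Surv s G G′ ρ ρ′) (sym (ℕ.+-suc m′ r)) d)
        x′ , d′ = f x
    in x′ ∷ xs′ , d′

  module _ {X : Vec (Fin m) k} {X′ : Vec (Fin n) k} where

    surv-tp : ∀ r {x x′} → Surv r G G′ (x ∷ X) (x′ ∷ X′) → tp G X x ≡ tp G′ X′ x′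
    surv-tp r d = tp-cong G G′ X X′ (link≡ (surv-same r d) zero ∘ suc)

    surv-reply : Surv 1 G G′ X X′ → ∀ x → ∃[ x′ ] tp G X x ≡ tp G′ X′ x′
    surv-reply (_ , f) x = let x′ , d = f x in x′ , surv-tp 0 d

    surv-pair : Surv 2 G G′ X X′ → ∀ x y → ∃₂ λ x′ y′ →
                tp G X x ≡ tp G′ X′ x′ × tp G X y ≡ tp G′ X′ y′ × link G x y ≡ link G′ x′ y′
    surv-pair (_ , f) x y =
      let x′ , d = f x
          y′ , s = proj₂ d y
      -- In the final position index 0 is the second move, index 1 the first, and `X` starts at
      -- index 2.
      in x′ , y′ , surv-tp 1 d , tp-cong G G′ X X′ (λ i → link≡ s zero (suc (suc i))) ,
         link≡ s (suc zero) zero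

    -- Spoiler plays `m₀` distinct members of `l`. Links record equality, so the replies are
    -- distinct, and the `j` rounds in reserve force each of them into `l′`.
    surv-fibre : ∀ j m₀ (l : List (Fin m)) (l′ : List (Fin n)) → Unique l →
                 (∀ {x x′} → Surv j G G′ (x ∷ X) (x′ ∷ X′) → x ∈ l → x′ ∈ l′) →
                 Surv (m₀ + j) G G′ X X′ → m₀ ≤ length l → m₀ ≤ length l′
    surv-fibre j m₀ l l′ l! pres d m₀≤ = Fin.injective⇒≤ {f = λ i → index (reply∈ i)} λ {i} {i₂} eq →
      Fin.inject≤-injective m₀≤ m₀≤ i i₂ (lookup-injective l! _ _
        (trans (sym (lookup∘tabulate _ i)) (trans
          (distinct i i₂ (index-injective (setoid _) (reply∈ i) (reply∈ i₂) eq))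
          (lookup∘tabulate _ i₂))))
      where
      xs : Vec (Fin m) m₀
      xs = tabulate λ i → List.lookup l (inject≤ i m₀≤)
      xs′ : Vec (Fin n) m₀
      xs′ = proj₁ (surv-play j xs d)
      d′ : Surv j G G′ (xs ++ X) (xs′ ++ X′)
      d′ = proj₂ (surv-play j xs d)
      one : ∀ i → Surv j G G′ (lookup xs i ∷ X) (lookup xs′ i ∷ X′)
      one i = surv-select j (λ where
        zero    → i ↑ˡ _ , lookup-++ˡ xs X i , lookup-++ˡ xs′ X′ i
        (suc t) → m₀ ↑ʳ t , lookup-++ʳ xs X t , lookup-++ʳ xs′ X′ t) d′
      reply∈ : ∀ i → lookup xs′ i ∈ l′
      reply∈ i = pres (one i) (subst (_∈ l) (sym (lookup∘tabulate _ i)) (∈-lookup _))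
      same′ : Same G G′ xs xs′
      same′ = same-select (λ i → i ↑ˡ _ , lookup-++ˡ xs X i , lookup-++ˡ xs′ X′ i)
                (surv-same j d′)
      distinct : ∀ i j → lookup xs′ i ≡ lookup xs′ j → lookup xs i ≡ lookup xs j
      distinct i j = link-≡ {G = G′} {G} (sym (link≡ same′ i j))

-- Two positions that Spoiler cannot tell apart

does-∧-cong : {P : Set} (P? : Dec P) {b c : Bool} → (P → b ≡ c) → does P? ∧ b ≡ does P? ∧ c
does-∧-cong (yes p) eq = eq p
does-∧-cong (no _)  eq = refl

does-∧-cancel : {P : Set} (P? : Dec P) {b c : Bool} → P → does P? ∧ b ≡ does P? ∧ c → b ≡ c
does-∧-cancel (yes _) p eq = eq
does-∧-cancel (no ¬p) p eq = contradiction p ¬p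

module Flags {n} = Fibres (≡-dec {n = n} Bool._≟_)

-- The position after Spoiler has played `X`. The hypothesis `rounds` says without subtraction that
-- `r` is at least `⌊(n + 3)/2⌋ − |X|`.
module Indistinguishable (G G′ : Graph n) (B : Base G) (X′ : Vec (Fin n) (Base.size B)) (r : ℕ)
  (forth : Surv r G G′ (Base.X B) X′) (back : Surv r G′ G X′ (Base.X B))
  (rounds : ∀ s → 2 * (Base.size B + s) ≤ n + 3 → s ≤ r) where

  open Base B
  open Types using (fibre; rest; fibre+rest; fibre-rest; deficit⇒surplus)

  T T′ : Fin n → Vec Link size
  T  = tp G X
  T′ = tp G′ X′

  V : List (Fin n)
  V = allFin n

  C C′ : Vec Link size → List (Fin n)
  C  τ = fibre T τ V
  C′ τ = fibre T′ τ V

  ∈C : ∀ {τ v} → T v ≡ τ → v ∈ C τ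
  ∈C = ∈-filter⁺ (λ v → T v ≟ₜ _) (∈-allFin _)

  ∈C′ : ∀ {τ v} → T′ v ≡ τ → v ∈ C′ τ
  ∈C′ = ∈-filter⁺ (λ v → T′ v ≟ₜ _) (∈-allFin _)

  C-tp : ∀ {τ v} → v ∈ C τ → T v ≡ τ
  C-tp = proj₂ ∘ ∈-filter⁻ (λ v → T v ≟ₜ _) {xs = V}

  C′-tp : ∀ {τ v} → v ∈ C′ τ → T′ v ≡ τ
  C′-tp = proj₂ ∘ ∈-filter⁻ (λ v → T′ v ≟ₜ _) {xs = V}

  C! : ∀ τ → Unique (C τ)
  C! τ = Unique.filter⁺ (λ v → T v ≟ₜ τ) (Unique.allFin⁺ n)

  C′! : ∀ τ → Unique (C′ τ)
  C′! τ = Unique.filter⁺ (λ v → T′ v ≟ₜ τ) (Unique.allFin⁺ n)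

  double : ∀ m j → 2 * (size + (suc m + j)) ≡ (suc (size + size) + suc (m + m)) + (j + j)
  double = eq size
    where
    eq : ∀ k m j → 2 * (k + (suc m + j)) ≡ (suc (k + k) + suc (m + m)) + (j + j)
    eq = solve-∀

  -- Here `2|X| + 1 ≤ |R|` pays for the moves spent on `X`: twice `|X| + (m + 1) + j` is
  -- `(2|X| + 1) + (2m + 1) + 2j`.
  enough : ∀ m j s → suc (m + m) ≤ s → length R + s + (j + j) ≤ n + 3 → suc m + j ≤ r
  enough m j s m≤s bound = rounds (suc m + j) (begin
    2 * (size + (suc m + j))                  ≡⟨ double m j ⟩
    suc (size + size) + suc (m + m) + (j + j) ≤⟨ ℕ.+-monoˡ-≤ (j + j) (ℕ.+-mono-≤ large m≤s) ⟩
    length R + s + (j + j)                    ≤⟨ bound ⟩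
    n + 3                                     ∎)
    where open ℕ.≤-Reasoning

  -- If α is larger in G than in G′ and β is smaller, Spoiler exposes the
  -- difference by exhausting the smaller of |α′| and |β|.
  balanced : ∀ j {α α′ β β′ : List (Fin n)} → Unique α → Unique β′ →
    (∀ {x x′} → Surv j G G′ (x ∷ X) (x′ ∷ X′) → x ∈ α → x′ ∈ α′) →
    (∀ {x x′} → Surv j G′ G (x′ ∷ X′) (x ∷ X) → x′ ∈ β′ → x ∈ β) →
    length R + (length α + length β) + (j + j) ≤ n + 3 →
    length α′ < length α → length β < length β′ → ⊥
  balanced j {α} {α′} {β} {β′} α! β′! α→α′ β′→β bound α′<α β<β′
    with ℕ.≤-total (length α′) (length β)
  -- Spoiler plays `|α′| + 1` members of `α`; `|α′| < |α|` and `|α′| ≤ |β|` give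
  -- `2|α′| + 1 ≤ |α| + |β|`. The other case is symmetric.
  ... | inj₁ α′≤β = contradiction
    (surv-fibre j (suc (length α′)) α α′ α! α→α′
      (surv-≤ (enough _ j _ (ℕ.+-mono-≤ α′<α α′≤β) bound) forth) α′<α)
    ℕ.1+n≰n
  ... | inj₂ β≤α′ = contradiction
    (surv-fibre j (suc (length β)) β′ β β′! β′→β
      (surv-≤ (enough _ j _ (ℕ.+-mono-≤ (ℕ.≤-<-trans β≤α′ α′<α) ℕ.≤-refl) bound) back)
      β<β′)
    ℕ.1+n≰n

  -- The orders are equal, so a class too large in `G` is compensated by one too small. Types are
  -- visible without further moves, hence `j = 0`.
  types-embed : ∀ τ → length (C τ) ≤ length (C′ τ)
  types-embed τ = ℕ.≮⇒≥ λ C′<C →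
    let σ , C<C′ = deficit⇒surplus T T′ τ V V ℕ.≤-refl C′<C
        σ≢τ = λ σ≡τ →
          ℕ.<-asym C′<C (subst (λ σ → length (C σ) < length (C′ σ)) σ≡τ C<C′)
    in balanced 0 (C! τ) (C′! σ)
         (λ s x∈ → ∈C′ (trans (sym (surv-tp 0 s)) (C-tp x∈)))
         (λ s x∈ → ∈C (trans (sym (surv-tp 0 s)) (C′-tp x∈)))
         (bound σ≢τ) C′<C C<C′
    where
    bound : ∀ {σ} → σ ≢ τ → length R + (length (C τ) + length (C σ)) + 0 ≤ n + 3
    bound {σ} σ≢τ = begin
      length R + (length (C τ) + length (C σ)) + 0 ≡⟨ ℕ.+-identityʳ _ ⟩
      length R + (length (C τ) + length (C σ))     ≤⟨ spread-two-classes G X R spread σ≢τ ⟩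
      n + 2                                        ≤⟨ ℕ.+-monoʳ-≤ n (ℕ.n≤1+n 2) ⟩
      n + 3                                        ∎
      where open ℕ.≤-Reasoning

  2≤r : 2 ≤ r
  2≤r = rounds 2 (begin
    2 * (size + 2)        ≡⟨ eq size ⟩
    suc (size + size) + 3 ≤⟨ ℕ.+-monoˡ-≤ 3 large ⟩
    length R + 3          ≤⟨ ℕ.+-monoˡ-≤ 3 (spread-length G X R spread) ⟩
    n + 3                 ∎)
    where
    open ℕ.≤-Reasoning
    eq : ∀ k → 2 * (k + 2) ≡ suc (k + k) + 3
    eq = solve-∀

  pair′ : ∀ x′ y′ → ∃₂ λ x y → T′ x′ ≡ T x × T′ y′ ≡ T y × link G′ x′ y′ ≡ link G x y
  pair′ = surv-pair (surv-≤ 2≤r back)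

  -- Being alone in one's class transfers between G and G′, since two moves in one
  -- graph test it; ψ sends such a vertex to its counterpart.
  Lone : Fin n → Set
  Lone w = ¬ Mate G X w

  lone? : ∀ w → Dec (Lone w)
  lone? w = ¬? (mate? G X w)

  lone-≡ : ∀ {v w} → Lone w → T v ≡ T w → v ≡ w
  lone-≡ {v} {w} lone eq = decidable-stable (v Fin.≟ w) λ v≢w → lone (v , v≢w , eq)

  ψ : Fin n → Fin n
  ψ w = proj₁ (surv-reply (surv-≤ (ℕ.≤-trans (s≤s z≤n) 2≤r) forth) w)

  T-ψ : ∀ w → T w ≡ T′ (ψ w)
  T-ψ w = proj₂ (surv-reply (surv-≤ (ℕ.≤-trans (s≤s z≤n) 2≤r) forth) w)

  -- If `v′` and `ψ w` differed, Spoiler would play both in `G′`; the replies have the type of `w`,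
  -- so both would be `w`.
  lone-ψ : ∀ {w v′} → Lone w → T′ v′ ≡ T w → v′ ≡ ψ w
  lone-ψ {w} {v′} lone eq =
    let a , b , v′~a , ψw~b , lnk = pair′ v′ (ψ w)
        a≡w = lone-≡ lone (trans (sym v′~a) eq)
        b≡w = lone-≡ lone (trans (sym ψw~b) (sym (T-ψ w)))
    in link-≡ {G = G} {G′} (sym lnk) (trans a≡w (sym b≡w))

  -- Adjacency to the lone vertices, with their counterparts in `G′`; entries at other vertices are
  -- constantly false.
  flags flags′ : Fin n → Vec Bool n
  flags  v  = tabulate λ w → does (lone? w) ∧ adj G v w
  flags′ v′ = tabulate λ w → does (lone? w) ∧ adj G′ v′ (ψ w)

  flags-cong : ∀ {v v′} → (∀ w → Lone w → adj G v w ≡ adj G′ v′ (ψ w)) → flags v ≡ flags′ v′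
  flags-cong eq = tabulate-cong λ w → does-∧-cong (lone? w) (eq w)

  flags-adj : ∀ {v v′} → flags v ≡ flags′ v′ → ∀ w → Lone w → adj G v w ≡ adj G′ v′ (ψ w)
  flags-adj eq w lone = does-∧-cancel (lone? w) lone
    (trans (sym (lookup∘tabulate _ w))
      (trans (cong (λ f → lookup f w) eq) (lookup∘tabulate _ w)))

  -- One further move at a lone `w` tests its entry, since the reply must be `ψ w`.
  flags-forth : ∀ {v v′} → Surv 1 G G′ (v ∷ X) (v′ ∷ X′) → flags v ≡ flags′ v′
  flags-forth {v} {v′} (_ , f) = flags-cong λ w lone →
    let w′ , s = f w
        w′≡ψw = lone-ψ lone (sym (tp-cong G G′ X X′ (λ i → link≡ s zero (suc (suc i)))))
    in trans (cong proj₂ (link≡ s (suc zero) zero)) (cong (adj G′ v′) w′≡ψw)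

  flags-back : ∀ {v v′} → Surv 1 G′ G (v′ ∷ X′) (v ∷ X) → flags v ≡ flags′ v′
  flags-back {v} {v′} (_ , f) = flags-cong λ w lone →
    let z , s = f (ψ w)
        z≡w = lone-≡ lone (trans (sym (tp-cong G′ G X′ X (λ i → link≡ s zero (suc (suc i))))) (sym (T-ψ w)))
    in sym (trans (cong proj₂ (link≡ s (suc zero) zero)) (cong (adj G v) z≡w))

  _≟f_ : DecidableEquality (Vec Bool n)
  _≟f_ = ≡-dec Bool._≟_

  F F′ : Vec Link size × Vec Bool n → List (Fin n)
  F  (τ , φ) = Flags.fibre flags φ (C τ)
  F′ (τ , φ) = Flags.fibre flags′ φ (C′ τ)

  F! : ∀ a → Unique (F a)
  F! (τ , φ) = Unique.filter⁺ (λ v → flags v ≟f φ) (C! τ)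

  F′! : ∀ a → Unique (F′ a)
  F′! (τ , φ) = Unique.filter⁺ (λ v → flags′ v ≟f φ) (C′! τ)

  ∈F : ∀ {a v} → (T v , flags v) ≡ a → v ∈ F a
  ∈F refl = ∈-filter⁺ (λ v → flags v ≟f _) (∈C refl) refl

  ∈F′ : ∀ {a v} → (T′ v , flags′ v) ≡ a → v ∈ F′ a
  ∈F′ refl = ∈-filter⁺ (λ v → flags′ v ≟f _) (∈C′ refl) refl

  F-type : ∀ {a v} → v ∈ F a → (T v , flags v) ≡ a
  F-type {τ , φ} v∈ = let v∈C , eq = ∈-filter⁻ (λ v → flags v ≟f φ) {xs = C τ} v∈
                      in cong₂ _,_ (C-tp v∈C) eq

  F′-type : ∀ {a v} → v ∈ F′ a → (T′ v , flags′ v) ≡ a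
  F′-type {τ , φ} v∈ = let v∈C , eq = ∈-filter⁻ (λ v → flags′ v ≟f φ) {xs = C′ τ} v∈
                       in cong₂ _,_ (C′-tp v∈C) eq

  -- By `types-embed` a deficit inside a class is compensated inside the same class. With one class
  -- involved instead of two, `spread-class` gives `n + 1`, and the 2 left up to `n + 3` pays for
  -- the extra move that reveals the flags.
  flagged-types-embed : ∀ a → length (F a) ≤ length (F′ a)
  flagged-types-embed (τ , φ) = ℕ.≮⇒≥ λ F′<F →
    let χ , F<F′ = Flags.deficit⇒surplus flags flags′ φ (C τ) (C′ τ) (types-embed τ) F′<F
        χ≢φ = λ χ≡φ →
          ℕ.<-asym F′<F (subst (λ χ → length (F (τ , χ)) < length (F′ (τ , χ))) χ≡φ F<F′)
    in balanced 1 (F! (τ , φ)) (F′! (τ , χ))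
         (λ s x∈ → ∈F′ (trans (sym (cong₂ _,_ (surv-tp 1 s) (flags-forth s))) (F-type x∈)))
         (λ s x∈ → ∈F (trans (cong₂ _,_ (sym (surv-tp 1 s)) (flags-back s)) (F′-type x∈)))
         (bound χ≢φ) F′<F F<F′
    where
    bound : ∀ {χ} → χ ≢ φ → length R + (length (F (τ , φ)) + length (F (τ , χ))) + 2 ≤ n + 3
    bound {χ} χ≢φ = begin
      length R + (length (F (τ , φ)) + length (F (τ , χ))) + 2
        ≤⟨ ℕ.+-monoˡ-≤ 2 (ℕ.+-monoʳ-≤ (length R) (Flags.two-fibres flags χ≢φ (C τ))) ⟩
      length R + length (C τ) + 2 ≤⟨ ℕ.+-monoˡ-≤ 2 (spread-class G X R spread τ) ⟩
      n + 1 + 2                   ≡⟨ ℕ.+-assoc n 1 2 ⟩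
      n + 3                       ∎
      where open ℕ.≤-Reasoning

  abstract
    matching : ∃[ π ] (Injective _≡_ _≡_ π × ∀ v → (T′ (π v) , flags′ (π v)) ≡ (T v , flags v))
    matching = fibrewise-injection (λ v → T v , flags v) (λ v → T′ v , flags′ v) F F′
                 (λ v → ∈F refl) F′-type F′! flagged-types-embed

  π : Fin n → Fin n
  π = proj₁ matching

  π-injective : Injective _≡_ _≡_ π
  π-injective = proj₁ (proj₂ matching)

  T-π : ∀ v → T′ (π v) ≡ T v
  T-π v = cong proj₁ (proj₂ (proj₂ matching) v)

  flags-π : ∀ v → flags v ≡ flags′ (π v)
  flags-π v = sym (cong proj₂ (proj₂ (proj₂ matching) v))

  adj-π-lone : ∀ x y → Lone y → adj G x y ≡ adj G′ (π x) (π y)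
  adj-π-lone x y lone = trans (flags-adj (flags-π x) y lone)
                              (cong (adj G′ (π x)) (sym (lone-ψ lone (T-π y))))

  -- A lone endpoint is covered by the flags. Otherwise, for distinct endpoints, two moves at `π x`
  -- and `π y` in `G′` yield a pair in `G` with the same types and adjacency, and homogeneity in `G`
  -- carries that adjacency to `x` and `y`.
  adj-π : ∀ x y → adj G x y ≡ adj G′ (π x) (π y)
  adj-π x y with mate? G X x | mate? G X y
  ... | _      | no lone = adj-π-lone x y lone
  ... | no lone | yes _  = trans (adj-sym G x y) (trans (adj-π-lone y x lone) (adj-sym G′ (π y) (π x)))
  ... | yes mx | yes my with x Fin.≟ y
  ... | yes refl = trans (dec-false (Graph.adj? G x x) (Graph.irref G refl))
                         (sym (dec-false (Graph.adj? G′ (π x) (π x)) (Graph.irref G′ refl)))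
  ... | no x≢y =
    let x₂ , y₂ , πx~x₂ , πy~y₂ , lnk = pair′ (π x) (π y)
        x₂≢y₂ : x₂ ≢ y₂
        x₂≢y₂ eq = x≢y (π-injective (link-≡ {G = G} {G′} (sym lnk) eq))
    in trans (homogeneous-pairs G X homogeneous mx my x≢y x₂≢y₂
                (trans (sym (T-π x)) πx~x₂) (trans (sym (T-π y)) πy~y₂))
             (sym (cong proj₂ lnk))

  isomorphic : G ≅ G′
  isomorphic = injection⇒↔ π-injective , λ x y → mk⇔
    (does-transport (Graph.adj? G x y) (Graph.adj? G′ (π x) (π y)) (adj-π x y))
    (does-transport (Graph.adj? G′ (π x) (π y)) (Graph.adj? G x y) (sym (adj-π x y)))

-- The number of rounds and the final bound

half : ∀ m → 2 * ⌊ m /2⌋ ≤ m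
half zero          = z≤n
half (suc zero)    = z≤n
half (suc (suc m)) = subst (_≤ suc (suc m)) (sym (ℕ.*-suc 2 ⌊ m /2⌋)) (s≤s (s≤s (half m)))

≤-half : ∀ s {m} → 2 * s ≤ m → s ≤ ⌊ m /2⌋
≤-half s {m} le = subst (_≤ ⌊ m /2⌋)
  (trans (cong (λ t → ⌊ s + t /2⌋) (ℕ.+-identityʳ s)) (sym (ℕ.n≡⌊n+n/2⌋ s))) (ℕ.⌊n/2⌋-mono le)

base-dup⇒≅ : (G G′ : Graph n) → Base G → Dup ⌊ n + 3 /2⌋ 2 2 G G′ [] [] → G ≅ G′
base-dup⇒≅ {n} G G′ B d =
  let X′ , _ , 0<a , d′ = dup-play G G′ X left (subst (λ N → Dup N 2 2 G G′ [] []) (sym size+left) d)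
  in Indistinguishable.isomorphic G G′ B X′ left (dup⇒surv left (s≤s z≤n) d′)
       (dup⇒surv left 0<a (dup-swap {r = left} d′)) rounds
  where
  open Base B
  -- The truncated subtraction is exact, because `2|X| < |R| ≤ n`.
  left = ⌊ n + 3 /2⌋ ∸ size
  size+left : size + left ≡ ⌊ n + 3 /2⌋
  size+left = ℕ.m+[n∸m]≡n (≤-half size (begin
    2 * size          ≡⟨ cong (size +_) (ℕ.+-identityʳ size) ⟩
    size + size       ≤⟨ ℕ.n≤1+n _ ⟩
    suc (size + size) ≤⟨ large ⟩
    length R          ≤⟨ spread-length G X R spread ⟩
    n                 ≤⟨ ℕ.m≤m+n n 3 ⟩
    n + 3             ∎))
    where open ℕ.≤-Reasoning
  rounds : ∀ s → 2 * (size + s) ≤ n + 3 → s ≤ left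
  rounds s le = subst (_≤ left) (ℕ.m+n∸m≡n size s) (ℕ.∸-monoˡ-≤ size (≤-half (size + s) le))

dup⇒≅ : (G G′ : Graph n) → Dup ⌊ n + 3 /2⌋ 2 2 G G′ [] [] → G ≅ G′
-- Without vertices there is no base, as `R` cannot be empty.
dup⇒≅ {zero}  G G′ _ = injection⇒↔ {π = λ x → x} (λ eq → eq) , λ ()
dup⇒≅ {suc n} G G′ d = base-dup⇒≅ G G′ (exists-base G) d

theorem3p15 : (n : ℕ) (G G′ : Graph n) → ¬ (G ≅ G′) →
    ∃[ d ] (D 1 G G′ d × 2 * d ≤ n + 3)
theorem3p15 n G G′ G≇G′ =
  let d , D-d , d≤N = D-bound G G′ ⌊ n + 3 /2⌋ (λ dup → G≇G′ (dup⇒≅ G G′ dup))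
  in d , D-d , ℕ.≤-trans (ℕ.*-monoʳ-≤ 2 d≤N) (half (n + 3))
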